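{- Let $\Lambda=\{\lambda_n\}_{n\ge 0}$ be a sequence of real numbers with $\lambda_0=1$, and let $n\ge 1$ be a natural number. Then $$V_n[\Lambda]=T_n[\Lambda]\,\bigl([1]\oplus V_{n-1}[\Lambda]\bigr),$$ where $\oplus$ denotes the direct sum (block-diagonal sum) of two matrices and $[1]$ is the $1\times 1$ identity matrix.
   Context: Rows and columns of matrices are indexed from $0$. Given a sequence $\Lambda=\{\lambda_n\}_{n\ge0}$, define numbers $a_{i,j}$ ($i,j\ge 0$) by $a_{i,0}=\lambda_i$ for $i\ge 0$, $a_{i,j}=0$ for $i<j$, and $$a_{i,j}=\sum_{l=j-1}^{i-1}\lambda_{i-1-l}\,a_{l,j-1}\qquad (i\ge j\ge 1).$$ The vertically-recurrent matrix associated with $\Lambda$, of order $(n+1)\times(n+1)$, is $V_n[\Lambda]=[a_{i,j}]_{0\le i,j\le n}$. The lower triangular Toeplitz matrix $T_n[\Lambda]$ is the $(n+1)\times(n+1)$ matrix whose $(i,j)$ entry is $\lambda_{i-j}$ if $i\ge j$ and $0$ if $i<j$ ($0\le i,j\le n$). -}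

module Defs where

open import Algebra.Bundles using (CommutativeRing)
import Algebra.Properties.CommutativeMonoid.Sum as Sum
open import Data.Bool.Base using (if_then_else_)
open import Data.Fin.Base using (Fin; toℕ; splitAt)
open import Data.Nat.Base as ℕ using (ℕ; zero; suc; _∸_; _<ᵇ_)
import Data.Nat.Properties as ℕₚ
open import Data.Product.Base using (Σ; ∃; _×_; _,_)
open import Data.Rational.Base
  using (ℚ; 0ℚ; 1ℚ; ½; _+_; _*_; _-_; -_; ∣_∣; 1/_; _≤_; Positive)
open import Data.Rational.Properties
open import Data.Rational.Solver using (module +-*-Solver)
open import Data.Sum.Base using (inj₁; inj₂)
open import Level using (Level; 0ℓ)
open import Relation.Binary.PropositionalEquality
  using (_≡_; refl; sym; trans; cong; subst)

------------------------------------------------------------------------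
-- The real numbers: Cauchy sequences of rationals, with two sequences
-- equal when their difference tends to 0.

record ℝ : Set where
  no-eta-equality
  field
    seq    : ℕ → ℚ
    cauchy : ∀ ε → .{{Positive ε}} →
             ∃ λ N → ∀ m n → N ℕ.≤ m → N ℕ.≤ n → ∣ seq m - seq n ∣ ≤ ε

open ℝ

infix 4 _≃_

record _≃_ (x y : ℝ) : Set where
  no-eta-equality
  field
    close : ∀ ε → .{{Positive ε}} →
            ∃ λ N → ∀ n → N ℕ.≤ n → ∣ seq x n - seq y n ∣ ≤ ε

open _≃_

private
  open +-*-Solver using (solve; _:=_; _:+_; _:*_; _:-_; :-_)

  ½-pos : ∀ ε → .{{Positive ε}} → Positive (½ * ε)
  ½-pos ε = pos*pos⇒pos ½ ε

  halves : ∀ ε → ½ * ε + ½ * ε ≡ ε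
  halves ε = trans (sym (*-distribʳ-+ ε ½ ½)) (*-identityˡ ε)

  split : ∀ a b c ε → c ≡ a + b → ∣ a ∣ ≤ ½ * ε → ∣ b ∣ ≤ ½ * ε → ∣ c ∣ ≤ ε
  split a b c ε c≡a+b ∣a∣≤ ∣b∣≤ = begin
    ∣ c ∣           ≡⟨ cong ∣_∣ c≡a+b ⟩
    ∣ a + b ∣       ≤⟨ ∣p+q∣≤∣p∣+∣q∣ a b ⟩
    ∣ a ∣ + ∣ b ∣   ≤⟨ +-mono-≤ ∣a∣≤ ∣b∣≤ ⟩
    ½ * ε + ½ * ε   ≡⟨ halves ε ⟩
    ε               ∎
    where open ≤-Reasoning

  ∣p-p∣≤ : ∀ p ε → .{{Positive ε}} → ∣ p - p ∣ ≤ ε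
  ∣p-p∣≤ p ε = begin
    ∣ p - p ∣   ≡⟨ cong ∣_∣ (+-inverseʳ p) ⟩
    0ℚ          ≤⟨ nonNegative⁻¹ ε {{pos⇒nonNeg ε}} ⟩
    ε           ∎
    where open ≤-Reasoning

  ∣p-q∣≡∣q-p∣ : ∀ p q → ∣ p - q ∣ ≡ ∣ q - p ∣
  ∣p-q∣≡∣q-p∣ p q = trans (sym (∣-p∣≡∣p∣ (p - q)))
    (cong ∣_∣ (solve 2 (λ p q → :- (p :- q) := q :- p) refl p q))

  ∣neg-neg∣ : ∀ p q → ∣ - p - - q ∣ ≡ ∣ p - q ∣
  ∣neg-neg∣ p q = trans
    (cong ∣_∣ (solve 2 (λ p q → (:- p) :- (:- q) := :- (p :- q)) refl p q))
    (∣-p∣≡∣p∣ (p - q))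

  ⊔ˡ : ∀ m n {k} → m ℕ.⊔ n ℕ.≤ k → m ℕ.≤ k
  ⊔ˡ m n = ℕₚ.m⊔n≤o⇒m≤o m n

  ⊔ʳ : ∀ m n {k} → m ℕ.⊔ n ℕ.≤ k → n ℕ.≤ k
  ⊔ʳ m n = ℕₚ.m⊔n≤o⇒n≤o m n

  Bounded : ℝ → Set
  Bounded x = Σ ℚ λ B → Positive B × ∃ λ N → ∀ n → N ℕ.≤ n → ∣ seq x n ∣ ≤ B

  bounded : ∀ x → Bounded x
  bounded x with cauchy x 1ℚ
  ... | N , p = ∣ seq x N ∣ + 1ℚ , nonNeg+pos⇒pos ∣ seq x N ∣ {{∣-∣-nonNeg (seq x N)}} 1ℚ , N , bound
    where
    open ≤-Reasoning
    bound : ∀ n → N ℕ.≤ n → ∣ seq x n ∣ ≤ ∣ seq x N ∣ + 1ℚ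
    bound n N≤n = begin
      ∣ seq x n ∣                           ≡⟨ cong ∣_∣ (solve 2 (λ a b → a := b :+ (a :- b)) refl (seq x n) (seq x N)) ⟩
      ∣ seq x N + (seq x n - seq x N) ∣     ≤⟨ ∣p+q∣≤∣p∣+∣q∣ (seq x N) _ ⟩
      ∣ seq x N ∣ + ∣ seq x n - seq x N ∣   ≤⟨ +-monoʳ-≤ ∣ seq x N ∣ (p n N N≤n ℕₚ.≤-refl) ⟩
      ∣ seq x N ∣ + 1ℚ                      ∎

  scale : (B ε : ℚ) → .{{Positive B}} → ℚ
  scale B ε = ½ * ε * (1/ B) {{pos⇒nonZero B}}

  scale-pos : ∀ B ε → .{{_ : Positive B}} → .{{Positive ε}} → Positive (scale B ε)
  scale-pos B ε = pos*pos⇒pos (½ * ε) {{½-pos ε}} ((1/ B) {{pos⇒nonZero B}}) {{1/pos⇒pos B}}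

  scaled : ∀ a d B ε → .{{_ : Positive B}} → ∣ a ∣ ≤ B → ∣ d ∣ ≤ scale B ε → ∣ a * d ∣ ≤ ½ * ε
  scaled a d B ε ∣a∣≤ ∣d∣≤ = begin
    ∣ a * d ∣                      ≡⟨ ∣p*q∣≡∣p∣*∣q∣ a d ⟩
    ∣ a ∣ * ∣ d ∣                  ≤⟨ *-monoʳ-≤-nonNeg ∣ d ∣ {{∣-∣-nonNeg d}} ∣a∣≤ ⟩
    B * ∣ d ∣                      ≤⟨ *-monoˡ-≤-nonNeg B {{pos⇒nonNeg B}} ∣d∣≤ ⟩
    B * (½ * ε * B⁻¹)              ≡⟨ solve 3 (λ b e i → b :* (e :* i) := e :* (b :* i)) refl B (½ * ε) B⁻¹ ⟩
    ½ * ε * (B * B⁻¹)              ≡⟨ cong (½ * ε *_) (*-inverseʳ B {{pos⇒nonZero B}}) ⟩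
    ½ * ε * 1ℚ                     ≡⟨ *-identityʳ (½ * ε) ⟩
    ½ * ε                          ∎
    where
    open ≤-Reasoning
    B⁻¹ = (1/ B) {{pos⇒nonZero B}}

  product-close : ∀ a b c d A D ε → .{{_ : Positive A}} → .{{_ : Positive D}} →
                  ∣ a ∣ ≤ A → ∣ d ∣ ≤ D → ∣ c - d ∣ ≤ scale A ε → ∣ a - b ∣ ≤ scale D ε →
                  ∣ a * c - b * d ∣ ≤ ε
  product-close a b c d A D ε ∣a∣≤ ∣d∣≤ c~d a~b =
    split (a * (c - d)) (d * (a - b)) (a * c - b * d) ε
    (solve 4 (λ a b c d → a :* c :- b :* d := a :* (c :- d) :+ d :* (a :- b)) refl a b c d)
    (scaled a (c - d) A ε ∣a∣≤ c~d) (scaled d (a - b) D ε ∣d∣≤ a~b)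

  pointwise : ∀ {x y} → (∀ n → seq x n ≡ seq y n) → x ≃ y
  pointwise {x} {y} eq .close ε = 0 , λ n _ →
    subst (λ q → ∣ seq x n - q ∣ ≤ ε) (eq n) (∣p-p∣≤ (seq x n) ε)

fromℚ : ℚ → ℝ
fromℚ q .seq _ = q
fromℚ q .cauchy ε = 0 , λ _ _ _ _ → ∣p-p∣≤ q ε

0ℝ 1ℝ : ℝ
0ℝ = fromℚ 0ℚ
1ℝ = fromℚ 1ℚ

infixl 6 _+ℝ_
infixl 7 _*ℝ_
infix  8 -ℝ_

_+ℝ_ : ℝ → ℝ → ℝ
(x +ℝ y) .seq n = seq x n + seq y n
(x +ℝ y) .cauchy ε =
  let M , p = cauchy x (½ * ε) {{½-pos ε}}
      N , q = cauchy y (½ * ε) {{½-pos ε}}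
  in M ℕ.⊔ N , λ m n m≥ n≥ → split (seq x m - seq x n) (seq y m - seq y n) _ ε
  (solve 4 (λ a b c d → (a :+ b) :- (c :+ d) := (a :- c) :+ (b :- d)) refl
    (seq x m) (seq y m) (seq x n) (seq y n))
  (p m n (⊔ˡ M N m≥) (⊔ˡ M N n≥)) (q m n (⊔ʳ M N m≥) (⊔ʳ M N n≥))

-ℝ_ : ℝ → ℝ
(-ℝ x) .seq n = - seq x n
(-ℝ x) .cauchy ε = let N , p = cauchy x ε in N , λ m n m≥ n≥ →
  subst (_≤ ε) (sym (∣neg-neg∣ (seq x m) (seq x n))) (p m n m≥ n≥)

_*ℝ_ : ℝ → ℝ → ℝ
(x *ℝ y) .seq n = seq x n * seq y n
(x *ℝ y) .cauchy ε =
  let A , A>0 , K , ∣x∣≤ = bounded x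
      D , D>0 , L , ∣y∣≤ = bounded y
      M , p = cauchy x (scale D ε {{D>0}}) {{scale-pos D ε {{D>0}}}}
      N , q = cauchy y (scale A ε {{A>0}}) {{scale-pos A ε {{A>0}}}}
  in (K ℕ.⊔ L) ℕ.⊔ (M ℕ.⊔ N) , λ m n m≥ n≥ →
    product-close (seq x m) (seq x n) (seq y m) (seq y n) A D ε {{A>0}} {{D>0}}
      (∣x∣≤ m (⊔ˡ K L (⊔ˡ (K ℕ.⊔ L) (M ℕ.⊔ N) m≥)))
      (∣y∣≤ n (⊔ʳ K L (⊔ˡ (K ℕ.⊔ L) (M ℕ.⊔ N) n≥)))
      (q m n (⊔ʳ M N (⊔ʳ (K ℕ.⊔ L) (M ℕ.⊔ N) m≥)) (⊔ʳ M N (⊔ʳ (K ℕ.⊔ L) (M ℕ.⊔ N) n≥)))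
      (p m n (⊔ˡ M N (⊔ʳ (K ℕ.⊔ L) (M ℕ.⊔ N) m≥)) (⊔ˡ M N (⊔ʳ (K ℕ.⊔ L) (M ℕ.⊔ N) n≥)))

private
  ≃ℝ-refl : ∀ {x} → x ≃ x
  ≃ℝ-refl = pointwise λ _ → refl

  ≃ℝ-sym : ∀ {x y} → x ≃ y → y ≃ x
  ≃ℝ-sym {x} {y} x≃y .close ε = let N , p = close x≃y ε in N , λ n n≥ → subst (_≤ ε) (∣p-q∣≡∣q-p∣ (seq x n) (seq y n)) (p n n≥)

  ≃ℝ-trans : ∀ {x y z} → x ≃ y → y ≃ z → x ≃ z
  ≃ℝ-trans {x} {y} {z} x≃y y≃z .close ε =
    let M , p = close x≃y (½ * ε) {{½-pos ε}}
        N , q = close y≃z (½ * ε) {{½-pos ε}}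
    in M ℕ.⊔ N , λ n n≥ → split (seq x n - seq y n) (seq y n - seq z n) _ ε
    (solve 3 (λ a b c → a :- c := (a :- b) :+ (b :- c)) refl (seq x n) (seq y n) (seq z n))
    (p n (⊔ˡ M N n≥)) (q n (⊔ʳ M N n≥))

  +-congℝ : ∀ {x x′ y y′} → x ≃ x′ → y ≃ y′ → x +ℝ y ≃ x′ +ℝ y′
  +-congℝ {x} {x′} {y} {y′} x≃ y≃ .close ε =
    let M , p = close x≃ (½ * ε) {{½-pos ε}}
        N , q = close y≃ (½ * ε) {{½-pos ε}}
    in M ℕ.⊔ N , λ n n≥ → split (seq x n - seq x′ n) (seq y n - seq y′ n) _ ε
    (solve 4 (λ a b c d → (a :+ b) :- (c :+ d) := (a :- c) :+ (b :- d)) refl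
      (seq x n) (seq y n) (seq x′ n) (seq y′ n))
    (p n (⊔ˡ M N n≥)) (q n (⊔ʳ M N n≥))

  -‿congℝ : ∀ {x y} → x ≃ y → -ℝ x ≃ -ℝ y
  -‿congℝ {x} {y} x≃y .close ε = let N , p = close x≃y ε in N , λ n n≥ →
    subst (_≤ ε) (sym (∣neg-neg∣ (seq x n) (seq y n))) (p n n≥)

  *-congℝ : ∀ {x x′ y y′} → x ≃ x′ → y ≃ y′ → x *ℝ y ≃ x′ *ℝ y′
  *-congℝ {x} {x′} {y} {y′} x≃ y≃ .close ε =
    let A , A>0 , K , ∣x∣≤ = bounded x
        D , D>0 , L , ∣y′∣≤ = bounded y′
        M , p = close x≃ (scale D ε {{D>0}}) {{scale-pos D ε {{D>0}}}}
        N , q = close y≃ (scale A ε {{A>0}}) {{scale-pos A ε {{A>0}}}}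
    in (K ℕ.⊔ L) ℕ.⊔ (M ℕ.⊔ N) , λ n n≥ →
      product-close (seq x n) (seq x′ n) (seq y n) (seq y′ n) A D ε {{A>0}} {{D>0}}
        (∣x∣≤ n (⊔ˡ K L (⊔ˡ (K ℕ.⊔ L) (M ℕ.⊔ N) n≥)))
        (∣y′∣≤ n (⊔ʳ K L (⊔ˡ (K ℕ.⊔ L) (M ℕ.⊔ N) n≥)))
        (q n (⊔ʳ M N (⊔ʳ (K ℕ.⊔ L) (M ℕ.⊔ N) n≥)))
        (p n (⊔ˡ M N (⊔ʳ (K ℕ.⊔ L) (M ℕ.⊔ N) n≥)))

  +-assocℝ : ∀ x y z → (x +ℝ y) +ℝ z ≃ x +ℝ (y +ℝ z)
  +-assocℝ x y z = pointwise λ n → +-assoc (seq x n) (seq y n) (seq z n)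

  +-commℝ : ∀ x y → x +ℝ y ≃ y +ℝ x
  +-commℝ x y = pointwise λ n → +-comm (seq x n) (seq y n)

  +-identityˡℝ : ∀ x → 0ℝ +ℝ x ≃ x
  +-identityˡℝ x = pointwise λ n → +-identityˡ (seq x n)

  +-identityʳℝ : ∀ x → x +ℝ 0ℝ ≃ x
  +-identityʳℝ x = pointwise λ n → +-identityʳ (seq x n)

  -‿inverseˡℝ : ∀ x → (-ℝ x) +ℝ x ≃ 0ℝ
  -‿inverseˡℝ x = pointwise λ n → +-inverseˡ (seq x n)

  -‿inverseʳℝ : ∀ x → x +ℝ (-ℝ x) ≃ 0ℝ
  -‿inverseʳℝ x = pointwise λ n → +-inverseʳ (seq x n)

  *-assocℝ : ∀ x y z → (x *ℝ y) *ℝ z ≃ x *ℝ (y *ℝ z)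
  *-assocℝ x y z = pointwise λ n → *-assoc (seq x n) (seq y n) (seq z n)

  *-commℝ : ∀ x y → x *ℝ y ≃ y *ℝ x
  *-commℝ x y = pointwise λ n → *-comm (seq x n) (seq y n)

  *-identityˡℝ : ∀ x → 1ℝ *ℝ x ≃ x
  *-identityˡℝ x = pointwise λ n → *-identityˡ (seq x n)

  *-identityʳℝ : ∀ x → x *ℝ 1ℝ ≃ x
  *-identityʳℝ x = pointwise λ n → *-identityʳ (seq x n)

  distribˡℝ : ∀ x y z → x *ℝ (y +ℝ z) ≃ x *ℝ y +ℝ x *ℝ z
  distribˡℝ x y z = pointwise λ n → *-distribˡ-+ (seq x n) (seq y n) (seq z n)

  distribʳℝ : ∀ x y z → (y +ℝ z) *ℝ x ≃ y *ℝ x +ℝ z *ℝ x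
  distribʳℝ x y z = pointwise λ n → *-distribʳ-+ (seq x n) (seq y n) (seq z n)

ℝ-commutativeRing : CommutativeRing 0ℓ 0ℓ
ℝ-commutativeRing = record
  { Carrier = ℝ
  ; _≈_ = _≃_
  ; _+_ = _+ℝ_
  ; _*_ = _*ℝ_
  ; -_  = -ℝ_
  ; 0#  = 0ℝ
  ; 1#  = 1ℝ
  ; isCommutativeRing = record
    { isRing = record
      { +-isAbelianGroup = record
        { isGroup = record
          { isMonoid = record
            { isSemigroup = record
              { isMagma = record
                { isEquivalence = record { refl = ≃ℝ-refl ; sym = ≃ℝ-sym ; trans = ≃ℝ-trans }
                ; ∙-cong = +-congℝ
                }
              ; assoc = +-assocℝ
              }
            ; identity = +-identityˡℝ , +-identityʳℝ
            }
          ; inverse = -‿inverseˡℝ , -‿inverseʳℝ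
          ; ⁻¹-cong = -‿congℝ
          }
        ; comm = +-commℝ
        }
      ; *-cong = *-congℝ
      ; *-assoc = *-assocℝ
      ; *-identity = *-identityˡℝ , *-identityʳℝ
      ; distrib = distribˡℝ , distribʳℝ
      }
    ; *-comm = *-commℝ
    }
  }

------------------------------------------------------------------------
-- Matrices, indexed from 0, with entries compared by the ring's equality

module Matrices {c ℓ : Level} (R : CommutativeRing c ℓ) where

  open CommutativeRing R
    using (Carrier; _≈_; 0#; 1#; +-commutativeMonoid) renaming (_*_ to _·_)
  open Sum +-commutativeMonoid using (sum)

  Matrix : ℕ → ℕ → Set c
  Matrix m n = Fin m → Fin n → Carrier

  infix  4 _≋_
  infixl 6 _⊕_
  infixl 7 _⊗_

  _≋_ : ∀ {m n} → Matrix m n → Matrix m n → Set ℓ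
  A ≋ B = ∀ i j → A i j ≈ B i j

  _⊗_ : ∀ {m n p} → Matrix m n → Matrix n p → Matrix m p
  (A ⊗ B) i j = sum λ k → A i k · B k j

  _⊕_ : ∀ {m n p q} → Matrix m n → Matrix p q → Matrix (m ℕ.+ p) (n ℕ.+ q)
  _⊕_ {m} {n} A B i j with splitAt m i | splitAt n j
  ... | inj₁ i′ | inj₁ j′ = A i′ j′
  ... | inj₁ _  | inj₂ _  = 0#
  ... | inj₂ _  | inj₁ _  = 0#
  ... | inj₂ i′ | inj₂ j′ = B i′ j′

  [1] : Matrix 1 1
  [1] _ _ = 1#

  -- The sum of f l over lo ≤ l < hi, which is empty when hi ≤ lo.
  sumFromTo : ℕ → ℕ → (ℕ → Carrier) → Carrier
  sumFromTo lo hi f = sum {hi ∸ lo} λ k → f (lo ℕ.+ toℕ k)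

  -- Column j + 1 sums over j ≤ l ≤ i - 1, so both truncated subtractions
  -- in i ∸ 1 ∸ l are exact.
  vr : (ℕ → Carrier) → ℕ → ℕ → Carrier
  vr Λ i zero    = Λ i
  vr Λ i (suc j) =
    if i <ᵇ suc j then 0# else sumFromTo j i λ l → Λ (i ∸ 1 ∸ l) · vr Λ l j

  V : (n : ℕ) → (ℕ → Carrier) → Matrix (suc n) (suc n)
  V n Λ i j = vr Λ (toℕ i) (toℕ j)

  T : (n : ℕ) → (ℕ → Carrier) → Matrix (suc n) (suc n)
  T n Λ i j = if toℕ i <ᵇ toℕ j then 0# else Λ (toℕ i ∸ toℕ j)

open Matrices ℝ-commutativeRing public

{-# OPTIONS --safe #-}
-- Column 0 of the product is column 0 of T, since the first column of
-- [1] ⊕ V is a unit vector. Entry (i + 1, j + 1) of the product is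
-- ∑ₖ T(i, k) · a(k, j); the terms with k > i vanish because T is lower
-- triangular and those with k < j because V is, which leaves the recurrence
-- defining a(i + 1, j + 1).
module Submission where

open import Defs
open import Data.Nat.Base using (ℕ; suc)

open import Algebra.Bundles using (CommutativeRing)
import Algebra.Properties.CommutativeMonoid.Sum as Sum
open import Data.Bool.Base using (true; false; if_then_else_) renaming (T to IsTrue)
open import Data.Empty using (⊥-elim)
open import Data.Fin.Base using (toℕ; zero; suc)
open import Data.Fin.Properties using (toℕ≤pred[n])
open import Data.Nat.Base using (zero; _∸_; _<ᵇ_; _≤_; _<_; z≤n; s≤s)
open import Data.Nat.Properties
  using (<ᵇ⇒<; <⇒<ᵇ; ≤⇒≯; m≤n⇒m∸n≡0)
open import Data.Unit.Base using (tt)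
open import Function.Base using (_∘_)
import Relation.Binary.PropositionalEquality as ≡
import Relation.Binary.Reasoning.Setoid as SetoidReasoning
open import Relation.Nullary.Negation using (¬_)

module _ {a} {A : Set a} {x y : A} where

  if-T : ∀ {b} → IsTrue b → (if b then x else y) ≡.≡ x
  if-T {true} _ = ≡.refl

  if-¬T : ∀ {b} → ¬ IsTrue b → (if b then x else y) ≡.≡ y
  if-¬T {false} _  = ≡.refl
  if-¬T {true}  ¬t = ⊥-elim (¬t tt)

module _ {c ℓ} (R : CommutativeRing c ℓ) where

  open CommutativeRing R renaming (_*_ to _·_)
  open Sum +-commutativeMonoid using (sum; sum-cong-≋; sum-replicate-zero)
  open SetoidReasoning setoid
  private module M = Matrices R

  sum-zero : ∀ {n} {f} → (∀ k → f k ≈ 0#) → sum {n} f ≈ 0#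
  sum-zero {n} f≈0 = trans (sum-cong-≋ f≈0) (sum-replicate-zero n)

  -- Cuts a matrix-product sum down to the support of a Toeplitz row. `g` may differ from `f`
  -- because the conditional in an entry of `T` simplifies to its `Λ` branch only below the cut.
  sum-truncate : ∀ {m n} {f g : ℕ → Carrier} → m ≤ n →
                 (∀ {l} → l < m → f l ≈ g l) → (∀ {l} → m ≤ l → f l ≈ 0#) →
                 sum {n} (f ∘ toℕ) ≈ sum {m} (g ∘ toℕ)
  sum-truncate {n = n} z≤n _ f≈0 = sum-zero {n} λ k → f≈0 {toℕ k} z≤n
  sum-truncate (s≤s m≤n) f≈g f≈0 =
    +-cong (f≈g (s≤s z≤n)) (sum-truncate m≤n (f≈g ∘ s≤s) (f≈0 ∘ s≤s))

  -- When `n ≤ m`, truncated subtraction makes the right side empty while every term on the left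
  -- vanishes; this case handles entries above the diagonal.
  sum-drop : ∀ m n {f : ℕ → Carrier} → (∀ {l} → l < m → f l ≈ 0#) →
             sum {n} (f ∘ toℕ) ≈ M.sumFromTo m n f
  sum-drop zero    _       _   = refl
  sum-drop (suc _) zero    _   = refl
  sum-drop (suc m) (suc n) f≈0 =
    trans (+-cong (f≈0 (s≤s z≤n)) (sum-drop m n (f≈0 ∘ s≤s))) (+-identityˡ _)

  sumFromTo-empty : ∀ {lo hi} f → hi ≤ lo → M.sumFromTo lo hi f ≈ 0#
  sumFromTo-empty f hi≤lo rewrite m≤n⇒m∸n≡0 hi≤lo = refl

  module _ (Λ : ℕ → Carrier) where

    vr-upper : ∀ {i j} → i < j → M.vr Λ i j ≈ 0#
    vr-upper {j = suc _} i<j = reflexive (if-T (<⇒<ᵇ i<j))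

    -- Above the diagonal `i < j` unfolds to `suc i ≤ j`, so the sum is empty and agrees with the
    -- default `0#`. The recurrence therefore takes one form on both sides of the diagonal.
    vr-suc : ∀ i j → M.vr Λ (suc i) (suc j) ≈
                     M.sumFromTo j (suc i) λ l → Λ (i ∸ l) · M.vr Λ l j
    vr-suc i j with i <ᵇ j in eq
    ... | false = refl
    ... | true  =
      sym (sumFromTo-empty (λ l → Λ (i ∸ l) · M.vr Λ l j) (<ᵇ⇒< i j (≡.subst IsTrue (≡.sym eq) tt)))

    -- The right side is entry (i + 1, j + 1) of the product without its index 0 term: a Toeplitz
    -- entry is unchanged when both indices drop by one, and the block `[1]` shifts `V` by one.
    toeplitz-vr : ∀ {i n} j → i ≤ n →
                  M.vr Λ (suc i) (suc j) ≈
                  sum {suc n} λ k → (if i <ᵇ toℕ k then 0# else Λ (i ∸ toℕ k)) · M.vr Λ (toℕ k) j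
    toeplitz-vr {i} {n} j i≤n = begin
      M.vr Λ (suc i) (suc j)           ≈⟨ vr-suc i j ⟩
      M.sumFromTo j (suc i) g          ≈⟨ sum-drop j (suc i) lower ⟨
      sum {suc i} (g ∘ toℕ)            ≈⟨ sum-truncate (s≤s i≤n) inside above ⟨
      sum {suc n} (f ∘ toℕ)            ∎
      where
      f g : ℕ → Carrier
      f l = (if i <ᵇ l then 0# else Λ (i ∸ l)) · M.vr Λ l j
      g l = Λ (i ∸ l) · M.vr Λ l j

      lower : ∀ {l} → l < j → g l ≈ 0#
      lower l<j = trans (*-congˡ (vr-upper l<j)) (zeroʳ _)

      inside : ∀ {l} → l < suc i → f l ≈ g l
      inside {l} (s≤s l≤i) =
        *-congʳ (reflexive (if-¬T (≤⇒≯ l≤i ∘ <ᵇ⇒< i l)))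

      above : ∀ {l} → suc i ≤ l → f l ≈ 0#
      above i<l = trans (*-congʳ (reflexive (if-T (<⇒<ᵇ i<l)))) (zeroˡ _)

    V-factorisation : ∀ n → M.V (suc n) Λ M.≋ M.T (suc n) Λ M.⊗ (M.[1] M.⊕ M.V n Λ)
    V-factorisation n i zero = begin
      Λ (toℕ i)              ≈⟨ *-identityʳ _ ⟨
      Λ (toℕ i) · 1#         ≈⟨ +-identityʳ _ ⟨
      Λ (toℕ i) · 1# + 0#    ≈⟨ +-congˡ (sum-zero {suc n} λ k → zeroʳ (M.T (suc n) Λ i (suc k))) ⟨
      _                      ∎
    V-factorisation n zero (suc j) = sym (begin
      -- The index 0 term meets the zero block of the direct sum; the others meet row 0 of `T` right
      -- of the diagonal.
      _          ≈⟨ +-cong (zeroʳ _) (sum-zero {suc n} λ k → zeroˡ (M.V n Λ k j)) ⟩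
      0# + 0#    ≈⟨ +-identityˡ _ ⟩
      0#         ∎)
    V-factorisation n (suc i) (suc j) = begin
      M.vr Λ (suc (toℕ i)) (suc (toℕ j))    ≈⟨ toeplitz-vr (toℕ j) (toℕ≤pred[n] i) ⟩
      -- Restores the index 0 term, whose second factor lies in the zero block to the right of
      -- `[1]`.
      _                                     ≈⟨ +-identityˡ _ ⟨
      0# + _                                ≈⟨ +-congʳ (zeroʳ _) ⟨
      _                                     ∎

theorem2p4 : (Λ : ℕ → ℝ) → Λ 0 ≃ 1ℝ →
    (n : ℕ) → V (suc n) Λ ≋ T (suc n) Λ ⊗ ([1] ⊕ V n Λ)
theorem2p4 Λ _ = V-factorisation ℝ-commutativeRing Λ
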